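{- Each of the eight combinators $\mathbf{P}$, $\mathbf{P}_3$, $\mathbf{D}_1$, $\mathbf{D}_2$, $\mathbf{\Phi}$, $\mathbf{\Phi}_2$, $\mathbf{S}_1$, $\mathbf{S}_2$ given by the reduction rules \begin{align*} &\mathbf{P}\, x\, y\, z \to z\,(x\,y\,z), && \mathbf{P}_3\, x\, y\, z \to y\,(x\,z\,y),\\ &\mathbf{D}_1\, x\, y\, z\, w \to x\,z\,(y\,w)\,(x\,z), && \mathbf{D}_2\, x\, y\, z\, w \to x\,w\,(y\,z)\,(x\,w),\\ &\mathbf{\Phi}\, x\, y\, z\, w \to x\,(y\,w)\,(z\,w), && \mathbf{\Phi}_2\, x\, y\, z\, w_1\, w_2 \to x\,(y\,w_1\,w_2)\,(z\,w_1\,w_2),\\ &\mathbf{S}_1\, x\, y\, z\, w \to x\,y\,w\,(z\,w), && \mathbf{S}_2\, x\, y\, z\, w \to x\,z\,w\,(y\,z\,w) \end{align*} is non-terminating. That is, for each $Z$ among these eight combinators, the sole combinatory calculus $R_Z$ is not terminating.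
   Context: Juxtaposition denotes function application and associates to the left. For a combinator $Z$, let $\Sigma_Z$ be the signature consisting of a constant $Z$ and a binary function symbol $@$ (application; $s\,t$ stands for $@(s,t)$). Given a reduction rule $Z\,x_1\cdots x_n\to e$, where $e$ is built from the variables $x_1,\dots,x_n$ by application, the sole combinatory calculus $R_Z$ is the term rewriting system over $\Sigma_Z$ with the single rule $@(\dots @(@(Z,x_1),x_2)\dots,x_n)\to e$. Its rewrite relation is $\{(C[l\alpha],C[r\alpha])\}$, where $l\to r$ is the rule, $\alpha$ is any substitution of terms over $\Sigma_Z$ (possibly with variables) for the variables of $l$, and $C$ is any one-hole context. $R_Z$ is terminating if there is no infinite rewrite sequence $t_0\to t_1\to t_2\to\cdots$; the combinator $Z$ is called terminating if $R_Z$ is terminating. -}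

module Defs where

open import Data.Fin.Base using (Fin)
open import Data.Fin.Patterns using (0F; 1F; 2F; 3F; 4F)
open import Data.List.Base using (allFin; foldl; map)
open import Data.Nat.Base using (ℕ; suc)
open import Data.Product.Base using (∃-syntax)
open import Relation.Nullary.Negation.Core using (¬_; contradiction)

infixl 7 _·_ _·ˡ_ _·ʳ_

-- Terms over Σ_Z with variables in V.  The signatures Σ_Z differ only in the
-- name of their constant, so a single type of terms serves for all of them.

data Term (V : Set) : Set where
  var : V → Term V
  Z   : Term V
  _·_ : Term V → Term V → Term V

substitute : {V W : Set} → (V → Term W) → Term V → Term W
substitute α (var x) = α x
substitute α Z       = Z
substitute α (s · t) = substitute α s · substitute α t

data Context (V : Set) : Set where
  □    : Context V
  _·ˡ_ : Context V → Term V → Context V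
  _·ʳ_ : Term V → Context V → Context V

plug : {V : Set} → Context V → Term V → Term V
plug □        t = t
plug (C ·ˡ s) t = plug C t · s
plug (s ·ʳ C) t = s · plug C t

-- The right-hand sides of combinators do not mention the constant.

data Body (n : ℕ) : Set where
  var : Fin n → Body n
  _·_ : Body n → Body n → Body n

record Combinator : Set where
  constructor combinator
  field
    arity : ℕ
    body  : Body arity

open Combinator public

toTerm : {n : ℕ} → Body n → Term (Fin n)
toTerm (var x) = var x
toTerm (s · t) = toTerm s · toTerm t

lhs rhs : (c : Combinator) → Term (Fin (arity c))
lhs c = foldl _·_ Z (map var (allFin (arity c)))
rhs c = toTerm (body c)

data _⊢_⟶_ (c : Combinator) : Term ℕ → Term ℕ → Set where
  step : (C : Context ℕ) (α : Fin (arity c) → Term ℕ) →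
         c ⊢ plug C (substitute α (lhs c)) ⟶ plug C (substitute α (rhs c))

InfiniteRewriteSequence : Combinator → (ℕ → Term ℕ) → Set
InfiniteRewriteSequence c t = ∀ n → c ⊢ t n ⟶ t (suc n)

Terminating : Combinator → Set
Terminating c = ¬ (∃[ t ] InfiniteRewriteSequence c t)

-- Classically this is ¬ Terminating c; constructively, the existence of an
-- infinite rewrite sequence is the stronger of the two.

NonTerminating : Combinator → Set
NonTerminating c = ∃[ t ] InfiniteRewriteSequence c t

nonTerminating⇒¬terminating : (c : Combinator) → NonTerminating c → ¬ Terminating c
nonTerminating⇒¬terminating c = contradiction

P P₃ D₁ D₂ Φ Φ₂ S₁ S₂ : Combinator

P = combinator 3 (z · (x · y · z))
  where x = var 0F; y = var 1F; z = var 2F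

P₃ = combinator 3 (y · (x · z · y))
  where x = var 0F; y = var 1F; z = var 2F

D₁ = combinator 4 (x · z · (y · w) · (x · z))
  where x = var 0F; y = var 1F; z = var 2F; w = var 3F

D₂ = combinator 4 (x · w · (y · z) · (x · w))
  where x = var 0F; y = var 1F; z = var 2F; w = var 3F

Φ = combinator 4 (x · (y · w) · (z · w))
  where x = var 0F; y = var 1F; z = var 2F; w = var 3F

Φ₂ = combinator 5 (x · (y · w₁ · w₂) · (z · w₁ · w₂))
  where x = var 0F; y = var 1F; z = var 2F; w₁ = var 3F; w₂ = var 4F

S₁ = combinator 4 (x · y · w · (z · w))
  where x = var 0F; y = var 1F; z = var 2F; w = var 3F

S₂ = combinator 4 (x · z · w · (y · z · w))
  where x = var 0F; y = var 1F; z = var 2F; w = var 3F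

{-# OPTIONS --safe #-}
-- For each combinator there is a set of terms, closed under application and
-- generated by a few seeds, together with a threshold N, such that a seed
-- applied to N members reduces to a term that has a subterm consisting of a
-- seed applied to at least N members.  Surplus members only enlarge the context
-- of that subterm, so the argument repeats forever.
module Submission where

open import Defs
open import Data.Nat.Base using (ℕ; zero; suc; _+_)
open import Data.Nat.Properties using (+-identityʳ; +-suc)
open import Data.Product.Base using (_×_; _,_; proj₁; ∃-syntax)
open import Data.Vec.Base using (Vec; []; _∷_; lookup)
open import Relation.Binary.Construct.Closure.Transitive using (TransClosure; [_]; _∷_)
open import Relation.Binary.PropositionalEquality.Core using (_≡_; refl; subst)

private
  variable
    c         : Combinator
    m n       : ℕ
    s t u     : Term ℕ
    x y z w v : Term ℕ

infix  4 _⊢_⟶⁺_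
infixl 7 _◃_
infixr 6 _▹_

_⊢_⟶⁺_ : Combinator → Term ℕ → Term ℕ → Set
c ⊢ s ⟶⁺ t = TransClosure (c ⊢_⟶_) s t

_◃_ : c ⊢ s ⟶ t → ∀ u → c ⊢ (s · u) ⟶ (t · u)
step C α ◃ u = step (C ·ˡ u) α

_▹_ : ∀ u → c ⊢ s ⟶ t → c ⊢ (u · s) ⟶ (u · t)
u ▹ step C α = step (u ·ʳ C) α

◃⁺ : c ⊢ s ⟶⁺ t → c ⊢ s · u ⟶⁺ t · u
◃⁺ [ r ]    = [ r ◃ _ ]
◃⁺ (r ∷ rs) = (r ◃ _) ∷ ◃⁺ rs

▹⁺ : c ⊢ s ⟶⁺ t → c ⊢ u · s ⟶⁺ u · t
▹⁺ [ r ]    = [ _ ▹ r ]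
▹⁺ (r ∷ rs) = (_ ▹ r) ∷ ▹⁺ rs

-- Taking the substitution from an explicit vector lets both sides compute, so each `rule` below can
-- display the contraction in expanded form.
contract : ∀ c (xs : Vec (Term ℕ) (arity c)) →
           c ⊢ substitute (lookup xs) (lhs c) ⟶ substitute (lookup xs) (rhs c)
contract c xs = step □ (lookup xs)

data Contains (Q : Term ℕ → Set) : Term ℕ → Set where
  here  : Q t → Contains Q t
  left  : Contains Q s → Contains Q (s · t)
  right : Contains Q t → Contains Q (s · t)

-- The closure is transitive but not reflexive: every round makes at least one step.
Productive : Combinator → (Term ℕ → Set) → Set
Productive c Q = ∀ {t} → Q t → ∃[ u ] (c ⊢ t ⟶⁺ u × Q u)

productive⇒nonTerminating : ∀ {Q} → Productive c Q → Q t → NonTerminating c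
productive⇒nonTerminating {c} {t} {Q} next q = term , rewrites
  where
  -- A state holds the current term and the pending steps to the next term satisfying `Q`, so each
  -- index of the sequence consumes exactly one step.
  State : Set
  State = ∃[ s ] ∃[ u ] (c ⊢ s ⟶⁺ u × Q u)

  advance : State → State
  advance (_ , u , [ _ ]         , q) = u , next q
  advance (_ , u , (_ ∷ rewrite⁺) , q) = _ , u , rewrite⁺ , q

  state : ℕ → State
  state zero    = t , next q
  state (suc n) = advance (state n)

  term : ℕ → Term ℕ
  term n = proj₁ (state n)

  rewrites-advance : ∀ σ → c ⊢ proj₁ σ ⟶ proj₁ (advance σ)
  rewrites-advance (_ , _ , [ r ]   , _) = r
  rewrites-advance (_ , _ , (r ∷ _) , _) = r

  rewrites : InfiniteRewriteSequence c term
  rewrites n = rewrites-advance (state n)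

contains-productive : ∀ {Q} → (∀ {t} → Q t → ∃[ u ] (c ⊢ t ⟶⁺ u × Contains Q u)) →
                      Productive c (Contains Q)
contains-productive next (here q)  = next q
contains-productive next (left p)  with u , r , p′ ← contains-productive next p = _ , ◃⁺ r , left p′
contains-productive next (right p) with u , r , p′ ← contains-productive next p = _ , ▹⁺ r , right p′

-- G n t is meant as: t is a seed applied to n members.
record Family (G : ℕ → Term ℕ → Set) : Set where
  field
    unapply : G (suc n) t → ∃[ s ] ∃[ a ] (t ≡ s · a × G n s)

  -- Dropping the `m` outermost arguments keeps the seed and its first `N` arguments, a prefix of
  -- the left spine.
  saturated : ∀ N m {t} → G (N + m) t → Contains (G N) t
  saturated N zero    {t} g = here (subst (λ k → G k t) (+-identityʳ N) g)
  saturated N (suc m) {t} g with _ , _ , refl , g′ ← unapply (subst (λ k → G k t) (+-suc N m) g) =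
    left (saturated N m g′)

  -- The surplus `m` is existential because the new head comes from a member that already carries an
  -- unknown number of arguments.
  Reproducing : Combinator → ℕ → Set
  Reproducing c N = ∀ {t} → G N t →
                    ∃[ u ] (c ⊢ t ⟶⁺ u × Contains (λ s → ∃[ m ] G (N + m) s) u)

  reproducing⇒nonTerminating : ∀ N → Reproducing c N → G N t → NonTerminating c
  reproducing⇒nonTerminating {c} N next g =
    productive⇒nonTerminating (contains-productive next′) (here g)
    where
    resaturate : Contains (λ s → ∃[ m ] G (N + m) s) u → Contains (G N) u
    resaturate (here (m , g)) = saturated N m g
    resaturate (left p)       = left (resaturate p)
    resaturate (right p)      = right (resaturate p)

    next′ : G N t → ∃[ u ] (c ⊢ t ⟶⁺ u × Contains (G N) u)
    next′ g with u , r , p ← next g = u , r , resaturate p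

open Family using (reproducing⇒nonTerminating)

infixl 7 _∙_

-- The index counts arguments along the left spine. An argument may have any index `n`: when it
-- moves to the head, it keeps its own arguments and gains further ones.
data Generated (core : Term ℕ) : ℕ → Term ℕ → Set where
  seed : Generated core 0 core
  _∙_  : Generated core m s → Generated core n t → Generated core (suc m) (s · t)

generated : ∀ {core} → Family (Generated core)
generated .Family.unapply (g ∙ _) = _ , _ , refl , g

module S₁ where

  rule : S₁ ⊢ (Z · x · y · z · w) ⟶ (x · y · w · (z · w))
  rule = contract S₁ (_ ∷ _ ∷ _ ∷ _ ∷ [])

  -- Three root contractions are available because the first argument of the leading `Z` is
  -- successively `Z · (Z · Z)`, `Z · Z` and `Z`.
  core : Term ℕ
  core = Z · (Z · (Z · Z)) · Z

  core-reduces : ∀ a b → let A = a · b in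
                 S₁ ⊢ core · a · b ⟶⁺ Z · Z · (b · A) · (A · (b · A))
  core-reduces _ _ = rule ∷ rule ∷ [ rule ]

  nonTerminating : NonTerminating S₁
  nonTerminating = reproducing⇒nonTerminating generated 2
    (λ { (seed ∙ a ∙ b) → _ , core-reduces _ _ , right (here (_ , a ∙ b ∙ (b ∙ (a ∙ b)))) })
    (seed ∙ seed ∙ seed)

module S₂ where

  rule : S₂ ⊢ (Z · x · y · z · w) ⟶ (x · z · w · (y · z · w))
  rule = contract S₂ (_ ∷ _ ∷ _ ∷ _ ∷ [])

  core : Term ℕ
  core = Z · (Z · Z)

  core-reduces : ∀ a b d e → let A = a · b · d; B = b · d · A in
                 S₂ ⊢ core · a · b · d · e ⟶⁺ d · B · e · (A · B · e)
  core-reduces _ _ _ _ = rule ◃ _ ∷ rule ◃ _ ∷ [ rule ]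

  nonTerminating : NonTerminating S₂
  nonTerminating = reproducing⇒nonTerminating generated 4
    (λ { (seed ∙ a ∙ b ∙ d ∙ e) → _ , core-reduces _ _ _ _ ,
         -- In `A · B · e` the member `a` is followed by `b` and `d` from `A`, then by `B` and `e`:
         -- four new arguments.
         right (here (_ , a ∙ b ∙ d ∙ (b ∙ d ∙ (a ∙ b ∙ d)) ∙ e)) })
    (seed ∙ seed ∙ seed ∙ seed ∙ seed)

module Φ where

  rule : Φ ⊢ (Z · x · y · z · w) ⟶ (x · (y · w) · (z · w))
  rule = contract Φ (_ ∷ _ ∷ _ ∷ _ ∷ [])

  -- This is `Z · Z · (Z · K · K)` with `K = Z · (Z · Z · Z)`. Since `K · p · q · r` reduces to
  -- `Z · (Z · (q · r)) · (p · r · (q · r))`, `K` acts like the combinator S within the right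
  -- argument.
  core : Term ℕ
  core = Z · Z · (Z · (Z · (Z · Z · Z)) · (Z · (Z · Z · Z)))

  core-reduces : ∀ a b d e → let E = a · b · e; F = d · e; Y = b · E · F in
                 Φ ⊢ core · a · b · d · e ⟶⁺ Z · (Z · Y) · (Z · (Z · (F · Y)) · (E · Y · (F · Y)))
  core-reduces _ _ _ _ =
    rule ◃ _ ◃ _ ∷ rule ∷ rule ◃ _ ∷ rule ∷ rule ∷ (_ ▹ rule) ∷ [ _ ▹ rule ]

  nonTerminating : NonTerminating Φ
  nonTerminating = reproducing⇒nonTerminating generated 4
    (λ { (seed ∙ a ∙ b ∙ d ∙ e) →
         let E = a ∙ b ∙ e; F = d ∙ e; Y = b ∙ E ∙ F in
         _ , core-reduces _ _ _ _ , right (right (here (_ , E ∙ Y ∙ (F ∙ Y)))) })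
    (seed ∙ seed ∙ seed ∙ seed ∙ seed)

module Φ₂ where

  rule : Φ₂ ⊢ (Z · x · y · z · w · v) ⟶ (x · (y · w · v) · (z · w · v))
  rule = contract Φ₂ (_ ∷ _ ∷ _ ∷ _ ∷ _ ∷ [])

  core : Term ℕ
  core = Z · Z · (Z · (Z · Z · Z) · (Z · Z))

  core-reduces : ∀ a b d e f g →
                 let E = a · b · d · f · g; F = e · f · g; Y = b · d · E in
                 Φ₂ ⊢ core · a · b · d · e · f · g ⟶⁺
                      Z · (Z · Y · F) · (Z · (d · Y · F) · (E · Y · F))
  core-reduces _ _ _ _ _ _ =
    rule ◃ _ ◃ _ ◃ _ ∷ rule ∷ rule ◃ _ ∷ rule ∷ [ _ ▹ rule ]

  nonTerminating : NonTerminating Φ₂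
  nonTerminating = reproducing⇒nonTerminating generated 6
    (λ { (seed ∙ a ∙ b ∙ d ∙ e ∙ f ∙ g) →
         -- `E` gives `a` four arguments; `Y` and `F` complete the six.
         let E = a ∙ b ∙ d ∙ f ∙ g; F = e ∙ f ∙ g; Y = b ∙ d ∙ E in
         _ , core-reduces _ _ _ _ _ _ , right (right (here (_ , E ∙ Y ∙ F))) })
    (seed ∙ seed ∙ seed ∙ seed ∙ seed ∙ seed ∙ seed)

-- Under `D₁` and `D₂` alike, contracting `Z · Z · Z · a · b` creates the arguments `Z · a` and
-- `Z · b`; hence a member prefixed by `Z` counts as a fresh seed.
data Generated₁ : ℕ → Term ℕ → Set where
  ZZZ : Generated₁ 0 (Z · Z · Z)
  Zg  : Generated₁ n t → Generated₁ 0 (Z · t)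
  _∙_ : Generated₁ m s → Generated₁ n t → Generated₁ (suc m) (s · t)

generated₁ : Family Generated₁
generated₁ .Family.unapply (g ∙ _) = _ , _ , refl , g

module D₁ where

  rule : D₁ ⊢ (Z · x · y · z · w) ⟶ (x · z · (y · w) · (x · z))
  rule = contract D₁ (_ ∷ _ ∷ _ ∷ _ ∷ [])

  nonTerminating : NonTerminating D₁
  nonTerminating = reproducing⇒nonTerminating generated₁ 3
    (λ { (ZZZ ∙ a ∙ b ∙ d)  → _ , rule ◃ _ ∷ [ rule ] ,
                              here (_ , a ∙ Zg a ∙ (Zg b ∙ d) ∙ (a ∙ Zg a))
       ; (Zg g ∙ a ∙ b ∙ d) → _ , [ rule ] , here (_ , g ∙ b ∙ (a ∙ d) ∙ (g ∙ b)) })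
    (ZZZ ∙ ZZZ ∙ ZZZ ∙ ZZZ)

module D₂ where

  rule : D₂ ⊢ (Z · x · y · z · w) ⟶ (x · w · (y · z) · (x · w))
  rule = contract D₂ (_ ∷ _ ∷ _ ∷ _ ∷ [])

  nonTerminating : NonTerminating D₂
  nonTerminating = reproducing⇒nonTerminating generated₁ 3
    (λ { (ZZZ ∙ a ∙ b ∙ d)  → _ , rule ◃ _ ∷ [ rule ] ,
                              here (_ , b ∙ d ∙ (Zg a ∙ Zg b) ∙ (b ∙ d))
       ; (Zg g ∙ a ∙ b ∙ d) → _ , [ rule ] , here (_ , g ∙ d ∙ (a ∙ b) ∙ (g ∙ d)) })
    (ZZZ ∙ ZZZ ∙ ZZZ ∙ ZZZ)

-- The seeds form a chain: reducing a `Zee` seed creates a `Zeg` seed among the arguments, reducing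
-- a `Zeg` seed creates a `Zgh` seed, and `Zgh` needs no further kind.
data Generated₂ (e : Term ℕ) : ℕ → Term ℕ → Set where
  Zee  : Generated₂ e 0 (Z · e · e)
  Zeg  : Generated₂ e n t → Generated₂ e 0 (Z · e · t)
  Zgh  : Generated₂ e m s → Generated₂ e n t → Generated₂ e 0 (Z · s · t)
  _∙_  : Generated₂ e m s → Generated₂ e n t → Generated₂ e (suc m) (s · t)

generated₂ : ∀ {e} → Family (Generated₂ e)
generated₂ .Family.unapply (g ∙ _) = _ , _ , refl , g

module P where

  rule : P ⊢ (Z · x · y · z) ⟶ (z · (x · y · z))
  rule = contract P (_ ∷ _ ∷ _ ∷ [])

  nonTerminating : NonTerminating P
  nonTerminating = reproducing⇒nonTerminating (generated₂ {Z}) 1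
    (λ { (Zee ∙ a)     → _ , [ rule ] , here (_ , a ∙ Zeg a)
       ; (Zeg g ∙ a)   → _ , [ rule ] , here (_ , a ∙ Zgh g a)
       ; (Zgh g h ∙ a) → _ , [ rule ] , here (_ , a ∙ (g ∙ h ∙ a)) })
    (Zee ∙ Zee)

module P₃ where

  rule : P₃ ⊢ (Z · x · y · z) ⟶ (y · (x · z · y))
  rule = contract P₃ (_ ∷ _ ∷ _ ∷ [])

  seed₁-reduces : ∀ a b → let A = a · (Z · (Z · Z) · a) in
                  P₃ ⊢ Z · (Z · Z) · (Z · Z) · a · b ⟶⁺ A · (Z · b · A)
  -- The inner contraction turns `Z · Z · a · (Z · Z)` into `A`, which the last contraction brings
  -- to the head.
  seed₁-reduces _ _ = rule ◃ _ ∷ (_ ▹ rule) ◃ _ ∷ [ rule ]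

  seed₂-reduces : ∀ g a b → P₃ ⊢ Z · (Z · Z) · g · a · b ⟶⁺ g · (a · (Z · g · a)) · b
  seed₂-reduces _ _ _ = rule ◃ _ ∷ [ (_ ▹ rule) ◃ _ ]

  nonTerminating : NonTerminating P₃
  nonTerminating = reproducing⇒nonTerminating (generated₂ {Z · Z}) 2
    (λ { (Zee ∙ a ∙ b)     → let A = a ∙ Zeg a in
                             _ , seed₁-reduces _ _ , here (_ , A ∙ Zgh b A)
       ; (Zeg g ∙ a ∙ b)   → _ , seed₂-reduces _ _ _ , here (_ , g ∙ (a ∙ Zgh g a) ∙ b)
       ; (Zgh g h ∙ a ∙ b) → _ , [ rule ◃ _ ] , here (_ , h ∙ (g ∙ a ∙ h) ∙ b) })
    (Zee ∙ Zee ∙ Zee)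

mainTheorem1 : NonTerminating P × NonTerminating P₃ ×
    NonTerminating D₁ × NonTerminating D₂ ×
    NonTerminating Φ × NonTerminating Φ₂ ×
    NonTerminating S₁ × NonTerminating S₂
mainTheorem1 =
  P.nonTerminating , P₃.nonTerminating , D₁.nonTerminating , D₂.nonTerminating ,
  Φ.nonTerminating , Φ₂.nonTerminating , S₁.nonTerminating , S₂.nonTerminating
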